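{- Let $S\subset(0,+\infty)$ and $\mathbf{X}\in\mathcal{U}_S$. There is $l\in\omega$ such that for every $\mathbf{Y}\in\mathcal{U}_S$ and every $k\in\omega\setminus\{0\}$ there is $\mathbf{Z}\in\mathcal{U}_S$ such that $\mathbf{Z}\to(\mathbf{Y})^{\mathbf{X}}_{k,l}$.
   Context: A metric space is ultrametric if $d(x,z)\le\max(d(x,y),d(y,z))$ for all $x,y,z$. For $S\subset(0,+\infty)$, $\mathcal{U}_S$ is the class of all finite ultrametric spaces with all nonzero distances in $S$. For ultrametric spaces $\mathbf{X},\mathbf{Z}$, $\binom{\mathbf{Z}}{\mathbf{X}}$ is the set of subsets of $\mathbf{Z}$ isometric to $\mathbf{X}$, and $\mathbf{Z}\to(\mathbf{Y})^{\mathbf{X}}_{k,l}$ means: for every $\chi:\binom{\mathbf{Z}}{\mathbf{X}}\to\{0,\dots,k-1\}$ there is $\widetilde{\mathbf{Y}}\in\binom{\mathbf{Z}}{\mathbf{Y}}$ such that $\chi$ takes at most $l$ values on $\binom{\widetilde{\mathbf{Y}}}{\mathbf{X}}$. -}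

module Defs where

open import Data.Nat using (ℕ)
open import Data.Fin using (Fin)
open import Data.Fin.Subset using (Subset; _∈_; _⊆_)
open import Data.Vec using (Vec)
import Data.Vec.Membership.Propositional as VM
open import Data.Product using (Σ; _×_)
open import Data.Sum using (_⊎_)
open import Function.Bundles using (_⇔_)
open import Relation.Binary.PropositionalEquality using (_≡_; _≢_)

-- Distances take values in a type T with a strict order _<_ (for the paper,
-- T = ℝ with its usual order) and a distinguished zero 0#.
module Ultra {T : Set} (_<_ : T → T → Set) (0# : T) (S : T → Set) where

  _≤_ : T → T → Set
  a ≤ b = a < b ⊎ a ≡ b

  record US : Set where
    field
      size  : ℕ
      d     : Fin size → Fin size → T
      d-zero : ∀ x y → (d x y ≡ 0#) ⇔ (x ≡ y)
      d-sym : ∀ x y → d x y ≡ d y x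
      -- d(x,z) ≤ max(d(x,y), d(y,z)), max written out (order is total)
      d-ultra : ∀ x y z → d x z ≤ d x y ⊎ d x z ≤ d y z
      d-S   : ∀ x y → x ≢ y → S (d x y)
  open US public

  IsCopy : (Z X : US) → Subset (size Z) → Set
  IsCopy Z X A =
    Σ (Fin (size X) → Fin (size Z)) λ f →
      (∀ i j → d Z (f i) (f j) ≡ d X i j) ×
      (∀ z → (z ∈ A) ⇔ Σ (Fin (size X)) λ i → f i ≡ z)

  -- Z → (Y)^X_{k,l}. A colouring of (Z choose X) is given as a function on all
  -- subsets of Z (its values on non-copies are irrelevant).
  Arrow : (Z Y X : US) → ℕ → ℕ → Set
  Arrow Z Y X k l =
    (χ : Subset (size Z) → Fin k) →
    Σ (Subset (size Z)) λ Ỹ → IsCopy Z Y Ỹ ×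
      Σ (Vec (Fin k) l) λ cs →
        ∀ A → A ⊆ Ỹ → IsCopy Z X A → χ A VM.∈ cs

{-# OPTIONS --safe #-}

-- Order the distances of Y decreasingly as s₀ > s₁ > … and let Z be the m-th
-- power of {0,…,M-1}, two tuples being at distance s_j when they first differ at
-- coordinate j. Number the nodes of the tree of balls of Y level by level and
-- lexicographically inside a level. An increasing map h from node numbers into
-- {0,…,M-1} sends a point of Y to the tuple of the h-images of the numbers of its
-- ancestors, which is an isometric embedding of Y in Z. A copy of X in Y determines
-- a set of node numbers, and the relative order of these numbers depends only on
-- the order of the points of the copy among the leaves of Y: on each level, balls
-- either coincide (which distances in X decide) or are ordered as their points are.
-- So for each of the finitely many order types on X, a colouring of the copies of X
-- is a colouring of p-subsets of {0,…,M-1}, and Ramsey's theorem, applied to all order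
-- types in turn, gives an h for which the colour of a copy depends on its order type only.
module Submission where

open import Defs
open import Data.Nat as ℕ using (ℕ; zero; suc; _+_; _*_; _^_; _≤?_; s≤s; z≤n)
import Data.Nat.Properties as ℕ
open import Data.Fin as Fin
  using (Fin; zero; suc; toℕ; fromℕ<; combine; remQuot; _↑ʳ_; funToFin; finToFun)
import Data.Fin.Properties as Fin
open import Data.Fin.Subset as Subset using (Subset)
import Data.Fin.Subset.Properties as Subset
open import Data.Bool using (if_then_else_)
open import Data.Maybe using (Maybe; just; nothing)
import Data.Maybe.Properties as Maybe
open import Data.Product using (Σ; _×_; _,_; proj₁; proj₂; uncurry)
open import Data.Sum using (_⊎_; inj₁; inj₂)
open import Data.Vec as Vec using (Vec; []; _∷_)
import Data.Vec.Properties as Vec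
import Data.Vec.Membership.Propositional as VM
import Data.Vec.Membership.Propositional.Properties as VM
open import Data.List
  using (List; []; _∷_; map; filter; length; take; allFin; lookup; cartesianProduct)
import Data.List.Properties as List
open import Data.List.Relation.Unary.All as All using (All; []; _∷_)
import Data.List.Relation.Unary.All.Properties as All
open import Data.List.Relation.Unary.AllPairs using (AllPairs; []; _∷_)
import Data.List.Relation.Unary.AllPairs.Properties as AllPairs
open import Data.List.Relation.Unary.Any as Any using (Any; here; there)
import Data.List.Relation.Unary.Any.Properties as Any
open import Data.List.Membership.Propositional using (_∈_)
open import Data.List.Membership.Propositional.Properties
  using (∈-allFin; ∈-lookup; ∈-map⁺; ∈-filter⁺; ∈-cartesianProduct⁺)
open import Data.List.Relation.Binary.Sublist.Propositional
  using (_⊆_; []; _∷_; _∷ʳ_; ⊆-trans; minimum)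
import Data.List.Relation.Binary.Sublist.Propositional.Properties as Sub
open import Function using (_∘_; id; flip)
open import Function.Bundles using (_⇔_; mk⇔; Equivalence)
open import Relation.Binary.Definitions using (tri<; tri≈; tri>)
open import Relation.Binary.PropositionalEquality
  using (_≡_; _≢_; refl; sym; trans; cong; cong₂; subst; subst₂)
open import Relation.Binary.Structures using (IsStrictTotalOrder)
open import Relation.Nullary using (Dec; does; yes; no; ¬_; ¬?; contradiction)
open import Relation.Nullary.Decidable using (dec-true)
open import Relation.Unary using (Decidable)

-- Ramsey's theorem for sublists of a list.

Homogeneous : {A : Set} {k : ℕ} → (List A → Fin k) → ℕ → List A → Fin k → Set
Homogeneous c p ys γ = ∀ zs → zs ⊆ ys → length zs ≡ p → c zs ≡ γ

-- The entry (y , γ) records the common colour γ of the (p+1)-sublists whose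
-- first element is y.
data EndHomogeneous {A : Set} {k} (c : List A → Fin k) (p : ℕ) : List (A × Fin k) → Set where
  []  : EndHomogeneous c p []
  _∷_ : ∀ {y γ ps} → Homogeneous (c ∘ (y ∷_)) p (map proj₁ ps) γ →
        EndHomogeneous c p ps → EndHomogeneous c p ((y , γ) ∷ ps)

endHomogeneous-⊆ : ∀ {A : Set} {k} {c : List A → Fin k} {p ps qs} → ps ⊆ qs →
                   EndHomogeneous c p qs → EndHomogeneous c p ps
endHomogeneous-⊆ []           []       = []
endHomogeneous-⊆ (_ ∷ʳ τ)     (_ ∷ hs) = endHomogeneous-⊆ τ hs
endHomogeneous-⊆ (refl ∷ τ)   (h ∷ hs) =
  (λ zs σ → h zs (⊆-trans σ (Sub.map⁺ proj₁ τ))) ∷ endHomogeneous-⊆ τ hs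

-- The first element of a sublist already fixes its colour, so a single recorded colour `γ` leaves
-- no other colour possible.
endHomogeneous⇒homogeneous : ∀ {A : Set} {k} {c : List A → Fin k} {p γ ps} →
  EndHomogeneous c p ps → All ((_≡ γ) ∘ proj₂) ps → Homogeneous c (suc p) (map proj₁ ps) γ
endHomogeneous⇒homogeneous []       []         .[]      []         ()
endHomogeneous⇒homogeneous (_ ∷ hs) (_ ∷ es)    zs       (_ ∷ʳ τ)   eq =
  endHomogeneous⇒homogeneous hs es zs τ eq
endHomogeneous⇒homogeneous (h ∷ _)  (refl ∷ _)  (_ ∷ zs) (refl ∷ τ) eq =
  h zs τ (ℕ.suc-injective eq)

length-filter-∁ : ∀ {A : Set} {P : A → Set} (P? : Decidable P) xs →
  length xs ≡ length (filter P? xs) + length (filter (¬? ∘ P?) xs)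
length-filter-∁ P? []       = refl
length-filter-∁ P? (x ∷ xs) with P? x
... | yes _ = cong suc (length-filter-∁ P? xs)
... | no  _ = trans (cong suc (length-filter-∁ P? xs)) (sym (ℕ.+-suc _ _))

-- Colours are tried one by one: either `γ` occurs `N` times, or discarding its entries loses fewer
-- than `N` of them, which the bound for the other colours allows.
pigeonhole : ∀ {A : Set} {k} N (γs : List (Fin k)) (ps : List (A × Fin k)) →
  All ((_∈ γs) ∘ proj₂) ps → length γs * N ℕ.< length ps →
  Σ (List (A × Fin k)) λ qs → qs ⊆ ps × length qs ≡ N ×
    Σ (Fin k) λ γ → All ((_≡ γ) ∘ proj₂) qs
pigeonhole N [] (_ ∷ _) (() ∷ _) _
pigeonhole N (γ ∷ γs) ps all∈ long with N ≤? length (filter ((Fin._≟ γ) ∘ proj₂) ps)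
... | yes N≤ = take N qs , ⊆-trans (Sub.take-⊆ N qs) (Sub.filter-⊆ γ? ps)
             , trans (List.length-take N qs) (ℕ.m≤n⇒m⊓n≡m N≤)
             , γ , All.take⁺ N (All.all-filter γ? ps)
  where
  γ? = (Fin._≟ γ) ∘ proj₂
  qs = filter γ? ps
... | no N≰ with pigeonhole N γs (filter (¬? ∘ γ?) ps) all∈′ long′
  where
  γ? = (Fin._≟ γ) ∘ proj₂
  all∈′ : All ((_∈ γs) ∘ proj₂) (filter (¬? ∘ γ?) ps)
  all∈′ = All.zipWith (λ { (here e , ne) → contradiction e ne ; (there i , _) → i })
            (All.filter⁺ (¬? ∘ γ?) all∈ , All.all-filter (¬? ∘ γ?) ps)
  long′ : length γs * N ℕ.< length (filter (¬? ∘ γ?) ps)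
  long′ = ℕ.+-cancelˡ-< N _ _ (ℕ.<-≤-trans
            (subst (N + length γs * N ℕ.<_) (length-filter-∁ γ? ps) long)
            (ℕ.+-monoˡ-≤ _ (ℕ.<⇒≤ (ℕ.≰⇒> N≰))))
...   | qs , τ , rest = qs , ⊆-trans τ (Sub.filter-⊆ _ ps) , rest

RamseyBound : ℕ → ℕ → ℕ → ℕ → Set₁
RamseyBound k p N M = ∀ {A : Set} (c : List A → Fin k) xs → M ℕ.≤ length xs →
  Σ (List A) λ ys → ys ⊆ xs × length ys ≡ N × Σ (Fin k) (Homogeneous c p ys)

-- Greedy peeling: the first element `x` induces a colouring of the `p`-sublists of the rest, and
-- `ram` shrinks the rest to a homogeneous list still long enough to continue.
endHomogeneousBound : ∀ {k p} → (∀ N → Σ ℕ (RamseyBound k p N)) → ∀ L →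
  Σ ℕ λ M → ∀ {A : Set} (c : List A → Fin k) xs → M ℕ.≤ length xs →
  Σ (List (A × Fin k)) λ ps → map proj₁ ps ⊆ xs × length ps ≡ L × EndHomogeneous c p ps
endHomogeneousBound ram zero    = 0 , λ c xs _ → [] , minimum xs , refl , []
endHomogeneousBound ram (suc L) with endHomogeneousBound ram L
... | M , bound with ram M
...   | M′ , bound′ = suc M′ , λ where
  c (x ∷ xs) (s≤s long) →
    let ys , ys⊆ , len , γ , hom = bound′ (c ∘ (x ∷_)) xs long
        ps , ps⊆ , len′ , end    = bound c ys (ℕ.≤-reflexive (sym len))
    in (x , γ) ∷ ps , refl ∷ ⊆-trans ps⊆ ys⊆ , cong suc len′
     , (λ zs τ → hom zs (⊆-trans τ ps⊆)) ∷ end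

ramsey : ∀ k p N → Σ ℕ (RamseyBound k p N)
ramsey k zero    N = N , λ c xs N≤ → take N xs , Sub.take-⊆ N xs
  , trans (List.length-take N xs) (ℕ.m≤n⇒m⊓n≡m N≤) , c [] , λ { [] _ _ → refl }
-- One entry more than `k * N` forces one of the `k` recorded colours to occur `N` times.
ramsey k (suc p) N with endHomogeneousBound (ramsey k p) (suc (length (allFin k) * N))
... | M , bound = M , λ c xs M≤ →
    let ps , ps⊆ , len , end     = bound c xs M≤
        qs , qs⊆ , len′ , γ , es = pigeonhole N (allFin k) ps (All.universal (∈-allFin ∘ proj₂) ps)
                                     (ℕ.≤-reflexive (sym len))
    in map proj₁ qs , ⊆-trans (Sub.map⁺ proj₁ qs⊆) ps⊆ , trans (List.length-map proj₁ qs) len′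
     , γ , endHomogeneous⇒homogeneous (endHomogeneous-⊆ qs⊆ end) es

-- `A` is quantified after `M` because the list coloured in the end is `allFin M`, whose type
-- mentions `M`.
FamilyRamseyBound : ∀ k {l} → (Fin l → ℕ) → ℕ → ℕ → Set₁
FamilyRamseyBound k {l} p N M = ∀ {A : Set} (c : Fin l → List A → Fin k) xs → M ℕ.≤ length xs →
  Σ (List A) λ ys → ys ⊆ xs × length ys ≡ N ×
    Σ (Vec (Fin k) l) λ γs → ∀ i → Homogeneous (c i) (p i) ys (Vec.lookup γs i)

-- The list homogeneous for the first colouring is made long enough to treat the others inside it;
-- homogeneity survives passing to sublists.
ramsey-family : ∀ k l (p : Fin l → ℕ) N → Σ ℕ (FamilyRamseyBound k p N)
ramsey-family k zero    p N = N , λ c xs N≤ → take N xs , Sub.take-⊆ N xs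
  , trans (List.length-take N xs) (ℕ.m≤n⇒m⊓n≡m N≤) , [] , λ ()
ramsey-family k (suc l) p N with ramsey-family k l (p ∘ suc) N
... | M , bound with ramsey k (p zero) M
...   | M′ , bound′ = M′ , λ c xs M′≤ →
    let ys , ys⊆ , len , γ , hom    = bound′ (c zero) xs M′≤
        zs , zs⊆ , len′ , γs , homs = bound (c ∘ suc) ys (ℕ.≤-reflexive (sym len))
    in zs , ⊆-trans zs⊆ ys⊆ , len′ , γ ∷ γs
     , λ { zero us τ → hom us (⊆-trans τ zs⊆) ; (suc i) → homs i }

-- Increasing lists and their sublists.

module _ {A : Set} {R : A → A → Set} where

  AllPairs-resp-⊆ : ∀ {xs ys} → xs ⊆ ys → AllPairs R ys → AllPairs R xs
  AllPairs-resp-⊆ []         []       = []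
  AllPairs-resp-⊆ (_ ∷ʳ τ)   (_ ∷ rs) = AllPairs-resp-⊆ τ rs
  AllPairs-resp-⊆ (refl ∷ τ) (r ∷ rs) = Sub.All-resp-⊆ τ r ∷ AllPairs-resp-⊆ τ rs

  AllPairs-lookup : ∀ {xs} → AllPairs R xs → ∀ {i j} → i Fin.< j → R (lookup xs i) (lookup xs j)
  AllPairs-lookup (r ∷ _)  {zero}  {suc j} _         = All.lookup r (∈-lookup j)
  AllPairs-lookup (_ ∷ rs) {suc _} {suc _} (s≤s i<j) = AllPairs-lookup rs i<j

  -- What follows an entry of `xs` is greater than it, so it can lie only further right in `ys`;
  -- hence `xs` can be matched from the left.
  increasing⇒⊆ : (∀ {x y z} → R x y → R y z → R x z) → (∀ {x} → ¬ R x x) → ∀ {xs ys} →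
    AllPairs R xs → AllPairs R ys → All (_∈ ys) xs → xs ⊆ ys
  increasing⇒⊆ trans irrefl {ys = ys} [] _ _ = minimum ys
  increasing⇒⊆ trans irrefl (r ∷ rs) (r′ ∷ rs′) (here refl ∷ ms) =
    refl ∷ increasing⇒⊆ trans irrefl rs rs′ (All.zipWith after (r , ms))
    where
    after : ∀ {z} → R _ z × z ∈ _ → z ∈ _
    after (Rzz , here refl) = contradiction Rzz irrefl
    after (_   , there m)   = m
  increasing⇒⊆ trans irrefl (r ∷ rs) (r′ ∷ rs′) (there m ∷ ms) =
    _ ∷ʳ increasing⇒⊆ trans irrefl (r ∷ rs) rs′ (m ∷ All.zipWith after (r , ms))
    where
    after : ∀ {z} → R _ z × z ∈ _ → z ∈ _
    after (Rxz , here refl) = contradiction (trans (All.lookup r′ m) Rxz) irrefl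
    after (_   , there m′)  = m′

allFin-increasing : ∀ n → AllPairs Fin._<_ (allFin n)
allFin-increasing n = AllPairs.tabulate⁺-< id

-- The equation turns sublists of `allFin N` into sublists of `ys`, where homogeneity applies;
-- injectivity will make the embedding of `Y` isometric.
enumeration : ∀ {M N} (ys : List (Fin M)) → ys ⊆ allFin M → length ys ≡ N →
  Σ (Fin N → Fin M) λ h → (∀ {i j} → h i ≡ h j → i ≡ j) × map h (allFin N) ≡ ys
enumeration {M} ys τ refl =
  lookup ys , inj , trans (List.map-tabulate id (lookup ys)) (List.tabulate-lookup ys)
  where
  inc : ∀ {i j} → i Fin.< j → lookup ys i Fin.< lookup ys j
  inc = AllPairs-lookup (AllPairs-resp-⊆ τ (allFin-increasing M))
  inj : ∀ {i j} → lookup ys i ≡ lookup ys j → i ≡ j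
  inj {i} {j} eq with Fin.<-cmp i j
  ... | tri< i<j _ _ = contradiction eq (Fin.<⇒≢ (inc i<j))
  ... | tri≈ _ i≡j _ = i≡j
  ... | tri> _ _ j<i = contradiction (sym eq) (Fin.<⇒≢ (inc j<i))

-- Sorting by an abstract comparison.

data Comparison : Set where
  lt eq gt : Comparison

module InsertionSort {Q : Set} (cmp : Q → Q → Comparison) where

  insert : Q → List Q → List Q
  insert q []       = q ∷ []
  insert q (w ∷ ws) with cmp q w
  ... | lt = q ∷ w ∷ ws
  -- `q` is dropped: two entries may name the same tree node, which is to be listed once.
  ... | eq = w ∷ ws
  ... | gt = w ∷ insert q ws

  sort : List Q → List Q
  sort []       = []
  sort (q ∷ qs) = insert q (sort qs)

  -- Reads ts as a list of values attached to the entries of ws.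
  decode : {A : Set} → List Q → List A → Q → Maybe A
  decode (w ∷ ws) (t ∷ ts) q with cmp w q
  ... | eq = just t
  ... | lt = decode ws ts q
  ... | gt = decode ws ts q
  decode _        _        _ = nothing

  All-insert : ∀ {P : Q → Set} {q ws} → P q → All P ws → All P (insert q ws)
  All-insert p [] = p ∷ []
  All-insert {q = q} {w ∷ ws} p (p′ ∷ ps) with cmp q w
  ... | lt = p ∷ p′ ∷ ps
  ... | eq = p′ ∷ ps
  ... | gt = p′ ∷ All-insert p ps

  All-sort : ∀ {P : Q → Set} {qs} → All P qs → All P (sort qs)
  All-sort []       = []
  All-sort (p ∷ ps) = All-insert p (All-sort ps)

  Any-insert : ∀ {P : Q → Set} q {ws} → Any P ws → Any P (insert q ws)
  Any-insert q {w ∷ ws} a with cmp q w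
  ... | lt = there a
  ... | eq = a
  Any-insert q {w ∷ ws} (here p)  | gt = here p
  Any-insert q {w ∷ ws} (there a) | gt = there (Any-insert q a)

  -- `cmp` compares names, and `g` gives the objects named. If `cmp` predicts the order of the
  -- objects, sorting without access to `g` still sorts them.
  module Faithful {B : Set} (_≺_ : B → B → Set)
    (≺-trans : ∀ {x y z} → x ≺ y → y ≺ z → x ≺ z) (≺-irrefl : ∀ {x} → ¬ (x ≺ x)) (g : Q → B) where

    Agrees : Comparison → Q → Q → Set
    Agrees lt q q′ = g q ≺ g q′
    Agrees eq q q′ = g q ≡ g q′
    Agrees gt q q′ = g q′ ≺ g q

    module _ (agrees : ∀ q q′ → Agrees (cmp q q′) q q′) where

      insert-increasing : ∀ q {ws} → AllPairs (λ v w → g v ≺ g w) ws →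
                          AllPairs (λ v w → g v ≺ g w) (insert q ws)
      insert-increasing q []                 = [] ∷ []
      insert-increasing q {w ∷ ws} (r ∷ rs) with cmp q w | agrees q w
      ... | lt | q≺w = (q≺w ∷ All.map (≺-trans q≺w) r) ∷ r ∷ rs
      ... | eq | _   = r ∷ rs
      ... | gt | w≺q = All-insert w≺q r ∷ insert-increasing q rs

      sort-increasing : ∀ qs → AllPairs (λ v w → g v ≺ g w) (sort qs)
      sort-increasing []       = []
      sort-increasing (q ∷ qs) = insert-increasing q (sort-increasing qs)

      insert-here : ∀ q ws → Any (λ w → g w ≡ g q) (insert q ws)
      insert-here q []       = here refl
      insert-here q (w ∷ ws) with cmp q w | agrees q w
      ... | lt | _   = here refl
      ... | eq | q≡w = here (sym q≡w)
      ... | gt | _   = there (insert-here q ws)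

      sort-complete : ∀ {q qs} → q ∈ qs → Any (λ w → g w ≡ g q) (sort qs)
      sort-complete {q} {_ ∷ qs} (here refl) = insert-here q (sort qs)
      sort-complete {q} {p ∷ qs} (there m)   = Any-insert p (sort-complete m)

      -- Entries comparing `lt` or `gt` have another value by irreflexivity, so the search stops at
      -- an entry whose value is `g q`.
      decode-map : ∀ {A : Set} (h : B → A) {ws q} → Any (λ w → g w ≡ g q) ws →
                   decode ws (map (h ∘ g) ws) q ≡ just (h (g q))
      decode-map h {w ∷ ws} {q} a with cmp w q | agrees w q
      decode-map h a                 | eq | e = cong (just ∘ h) e
      decode-map h {q = q} (here e)  | lt | l = contradiction (subst (_≺ g q) e l) ≺-irrefl
      decode-map h (there a)         | lt | _ = decode-map h a
      decode-map h {q = q} (here e)  | gt | l = contradiction (subst (g q ≺_) e l) ≺-irrefl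
      decode-map h (there a)         | gt | _ = decode-map h a

-- Decidable subsets, and functions coded as numbers.

module _ {n} {P : Fin n → Set} (P? : Decidable P) where

  comprehension : Subset n
  comprehension = Vec.tabulate (does ∘ P?)

  ∈-comprehension⁺ : ∀ {i} → P i → i Subset.∈ comprehension
  ∈-comprehension⁺ {i} p = Vec.lookup⇒[]= i _ (trans (Vec.lookup∘tabulate _ i) (dec-true (P? i) p))

  ∈-comprehension⁻ : ∀ {i} → i Subset.∈ comprehension → P i
  ∈-comprehension⁻ {i} m with P? i | trans (sym (Vec.lookup∘tabulate (does ∘ P?) i)) (Vec.[]=⇒lookup m)
  ... | yes p | _ = p

funToFin-cong : ∀ {m n} {f g : Fin m → Fin n} → (∀ i → f i ≡ g i) → funToFin f ≡ funToFin g
funToFin-cong {zero}  eqs = refl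
funToFin-cong {suc m} eqs = cong₂ combine (eqs zero) (funToFin-cong (eqs ∘ suc))

finToFun-injective : ∀ {m n} {x y : Fin (m ^ n)} →
  (∀ i → finToFun {m} {n} x i ≡ finToFun y i) → x ≡ y
finToFun-injective {m} {n} {x} {y} eqs =
  trans (sym (Fin.funToFin-finToFin {n} {m} x))
    (trans (funToFin-cong eqs) (Fin.funToFin-finToFin {n} {m} y))

-- Numbering the nodes of a tree.

-- Given the names b j y of the depth-j ancestors of the points y of a tree (each
-- name being unambiguous among siblings only), the nodes are numbered level by
-- level, from the root, lexicographically within each level.
module Numbering {Y : Set} (K : ℕ) where

  -- Earlier levels use numbers below `hi`, hence the shift. The parent's number is the leading
  -- digit and the name the last one, which gives the lexicographic order.
  next : ∀ {hi} → (Y → Fin hi) → (Y → Fin K) → Y → Fin (hi + hi * K)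
  next {hi} acc b y = hi ↑ʳ combine (acc y) (b y)

  top : ℕ → ℕ → ℕ
  top zero    hi = hi
  top (suc m) hi = top m (hi + hi * K)

  number : ∀ {m hi} → (Fin m → Y → Fin K) → (Y → Fin hi) → Fin m → Y → ℕ
  number b acc zero    y = toℕ (next acc (b zero) y)
  number b acc (suc j) y = number (b ∘ suc) (next acc (b zero)) j y

  final : ∀ {m hi} → (Fin m → Y → Fin K) → (Y → Fin hi) → Y → Fin (top m hi)
  final {zero}  b acc = acc
  final {suc m} b acc = final (b ∘ suc) (next acc (b zero))

  ≤top : ∀ m hi → hi ℕ.≤ top m hi
  ≤top zero    hi = ℕ.≤-refl
  ≤top (suc m) hi = ℕ.≤-trans (ℕ.m≤m+n hi (hi * K)) (≤top m _)

  ≤number : ∀ {m hi} (b : Fin m → Y → Fin K) (acc : Y → Fin hi) j y → hi ℕ.≤ number b acc j y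
  ≤number b acc zero    y = subst (_ ℕ.≤_) (sym (Fin.toℕ-↑ʳ _ (combine (acc y) (b zero y))))
    (ℕ.m≤m+n _ _)
  ≤number b acc (suc j) y = ℕ.≤-trans (ℕ.m≤m+n _ _) (≤number (b ∘ suc) (next acc (b zero)) j y)

  number<top : ∀ {m hi} (b : Fin m → Y → Fin K) (acc : Y → Fin hi) j y →
               number b acc j y ℕ.< top m hi
  number<top {suc m} b acc zero    y = ℕ.<-≤-trans (Fin.toℕ<n (next acc (b zero) y)) (≤top m _)
  number<top         b acc (suc j) y = number<top (b ∘ suc) (next acc (b zero)) j y

  number-level-< : ∀ {m hi} (b : Fin m → Y → Fin K) (acc : Y → Fin hi) {i j} → i Fin.< j →
                   ∀ y y′ → number b acc i y ℕ.< number b acc j y′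
  number-level-< b acc {zero}  {suc j} _ y y′ =
    ℕ.<-≤-trans (Fin.toℕ<n (next acc (b zero) y)) (≤number (b ∘ suc) (next acc (b zero)) j y′)
  number-level-< b acc {suc i} {suc j} (s≤s i<j) = number-level-< (b ∘ suc) (next acc (b zero)) i<j

  next-mono-< : ∀ {hi} (acc : Y → Fin hi) b {y y′} → acc y Fin.< acc y′ →
                next acc b y Fin.< next acc b y′
  next-mono-< {hi} acc b {y} {y′} l =
    subst₂ ℕ._<_ (sym (Fin.toℕ-↑ʳ hi (combine (acc y) (b y))))
      (sym (Fin.toℕ-↑ʳ hi (combine (acc y′) (b y′))))
      (ℕ.+-monoʳ-< hi (Fin.combine-monoˡ-< (b y) (b y′) l))

  final-mono-< : ∀ {m hi} (b : Fin m → Y → Fin K) (acc : Y → Fin hi) {y y′} →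
                 acc y Fin.< acc y′ → final b acc y Fin.< final b acc y′
  final-mono-< {zero}  b acc l = l
  final-mono-< {suc m} b acc l = final-mono-< (b ∘ suc) (next acc (b zero)) (next-mono-< acc (b zero) l)

  -- As a leading digit, the number of an ancestor passes its strict order on to all descendants; so
  -- the order on the last level decides the order on every level where ancestors differ.
  number<⇒final< : ∀ {m hi} (b : Fin m → Y → Fin K) (acc : Y → Fin hi) j {y y′} →
                   number b acc j y ℕ.< number b acc j y′ → final b acc y Fin.< final b acc y′
  number<⇒final< b acc zero    = final-mono-< (b ∘ suc) (next acc (b zero))
  number<⇒final< b acc (suc j) = number<⇒final< (b ∘ suc) (next acc (b zero)) j

  number-injective : ∀ {m hi} (b : Fin m → Y → Fin K) (acc : Y → Fin hi) j {y y′} →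
                     number b acc j y ≡ number b acc j y′ → b j y ≡ b j y′
  number-injective {hi = hi} b acc zero {y} {y′} e =
    Fin.combine-injectiveʳ (acc y) (b zero y) (acc y′) (b zero y′)
      (Fin.↑ʳ-injective hi _ _ (Fin.toℕ-injective e))
  number-injective b acc (suc j) = number-injective (b ∘ suc) (next acc (b zero)) j

  number-cong : ∀ {m hi} (b : Fin m → Y → Fin K) (acc : Y → Fin hi) j {y y′} → acc y ≡ acc y′ →
                (∀ {i} → i Fin.≤ j → b i y ≡ b i y′) → number b acc j y ≡ number b acc j y′
  number-cong {hi = hi} b acc zero    e es = cong toℕ (cong₂ (λ a c → hi ↑ʳ combine a c) e (es z≤n))
  number-cong {hi = hi} b acc (suc j) e es = number-cong (b ∘ suc) (next acc (b zero)) j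
    (cong₂ (λ a c → hi ↑ʳ combine a c) e (es z≤n)) (es ∘ s≤s)

-- The ultrametric on tuples given by the first difference.

module UltrametricRamsey {T : Set} (_<_ : T → T → Set) (isSTO : IsStrictTotalOrder _≡_ _<_)
  (0# : T) (S : T → Set) (S-positive : ∀ s → S s → 0# < s) where

  open Ultra _<_ 0# S
  open IsStrictTotalOrder isSTO using (compare; _<?_) renaming (trans to <-trans; irrefl to <-irrefl)
  open Equivalence using (to; from)

  Decreasing : ∀ {m} → (Fin m → T) → Set
  Decreasing s = ∀ {i j} → i Fin.< j → s j < s i

  dist : ∀ {m M} → (Fin m → T) → (u v : Fin m → Fin M) → T
  dist {zero}  s u v = 0#
  dist {suc m} s u v with u zero Fin.≟ v zero
  ... | yes _ = dist (s ∘ suc) (u ∘ suc) (v ∘ suc)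
  ... | no  _ = s zero

  dist-value : ∀ {m M} (s : Fin m → T) (u v : Fin m → Fin M) →
               dist s u v ≡ 0# ⊎ Σ (Fin m) λ j → dist s u v ≡ s j
  dist-value {zero}  s u v = inj₁ refl
  dist-value {suc m} s u v with u zero Fin.≟ v zero
  ... | no  _ = inj₂ (zero , refl)
  ... | yes _ with dist-value (s ∘ suc) (u ∘ suc) (v ∘ suc)
  ...   | inj₁ e       = inj₁ e
  ...   | inj₂ (j , e) = inj₂ (suc j , e)

  -- As `s` decreases, the levels above `δ` form an initial segment. The tuples agree exactly there,
  -- so they first differ at the level of value `δ`, or nowhere if `δ` is `0#`.
  dist-unique : ∀ {m M} (s : Fin m → T) → Decreasing s → (∀ j → 0# < s j) →
    (u v : Fin m → Fin M) → ∀ {δ} → δ ≡ 0# ⊎ Σ (Fin m) (λ j → δ ≡ s j) → (∀ j → u j ≡ v j ⇔ δ < s j) → dist s u v ≡ δ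
  dist-unique {zero}  s dec pos u v (inj₁ refl) agree = refl
  dist-unique {suc m} s dec pos u v val agree with u zero Fin.≟ v zero
  dist-unique {suc m} s dec pos u v (inj₁ refl) agree | yes _ =
    dist-unique (s ∘ suc) (dec ∘ s≤s) (pos ∘ suc) (u ∘ suc) (v ∘ suc) (inj₁ refl) (agree ∘ suc)
  dist-unique {suc m} s dec pos u v (inj₂ (zero , refl)) agree | yes e =
    contradiction (to (agree zero) e) (<-irrefl refl)
  dist-unique {suc m} s dec pos u v (inj₂ (suc j , refl)) agree | yes _ =
    dist-unique (s ∘ suc) (dec ∘ s≤s) (pos ∘ suc) (u ∘ suc) (v ∘ suc) (inj₂ (j , refl)) (agree ∘ suc)
  dist-unique {suc m} s dec pos u v (inj₁ refl) agree | no ne =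
    contradiction (from (agree zero) (pos zero)) ne
  dist-unique {suc m} s dec pos u v (inj₂ (zero , refl)) agree | no ne = refl
  dist-unique {suc m} s dec pos u v (inj₂ (suc j , refl)) agree | no ne =
    contradiction (from (agree zero) (dec (s≤s z≤n))) ne

  dist-refl : ∀ {m M} (s : Fin m → T) (u v : Fin m → Fin M) → (∀ j → u j ≡ v j) → dist s u v ≡ 0#
  dist-refl {zero}  s u v e = refl
  dist-refl {suc m} s u v e with u zero Fin.≟ v zero
  ... | yes _ = dist-refl (s ∘ suc) (u ∘ suc) (v ∘ suc) (e ∘ suc)
  ... | no ne = contradiction (e zero) ne

  dist-zero : ∀ {m M} (s : Fin m → T) → (∀ j → 0# < s j) → (u v : Fin m → Fin M) →
              dist s u v ≡ 0# → ∀ j → u j ≡ v j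
  dist-zero {suc m} s pos u v e j with u zero Fin.≟ v zero
  ... | no _ = contradiction (pos zero) (<-irrefl (sym e))
  dist-zero s pos u v e zero    | yes e₀ = e₀
  dist-zero s pos u v e (suc j) | yes _  = dist-zero (s ∘ suc) (pos ∘ suc) (u ∘ suc) (v ∘ suc) e j

  dist-sym : ∀ {m M} (s : Fin m → T) (u v : Fin m → Fin M) → dist s u v ≡ dist s v u
  dist-sym {zero}  s u v = refl
  dist-sym {suc m} s u v with u zero Fin.≟ v zero | v zero Fin.≟ u zero
  ... | yes _ | yes _ = dist-sym (s ∘ suc) (u ∘ suc) (v ∘ suc)
  ... | yes e | no ne = contradiction (sym e) ne
  ... | no ne | yes e = contradiction (sym e) ne
  ... | no _  | no _  = refl

  dist-≤ : ∀ {m M} (s : Fin (suc m) → T) → Decreasing s → (∀ j → 0# < s j) → (u v : Fin m → Fin M) →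
           dist (s ∘ suc) u v ≤ s zero
  dist-≤ s dec pos u v with dist-value (s ∘ suc) u v
  ... | inj₁ e       = inj₁ (subst (_< s zero) (sym e) (pos zero))
  ... | inj₂ (j , e) = inj₁ (subst (_< s zero) (sym e) (dec (s≤s z≤n)))

  dist-ultra : ∀ {m M} (s : Fin m → T) → Decreasing s → (∀ j → 0# < s j) → (u v w : Fin m → Fin M) →
               dist s u w ≤ dist s u v ⊎ dist s u w ≤ dist s v w
  dist-ultra {zero}  s dec pos u v w = inj₁ (inj₂ refl)
  dist-ultra {suc m} s dec pos u v w
    with u zero Fin.≟ w zero | u zero Fin.≟ v zero | v zero Fin.≟ w zero
  ... | yes _ | yes _ | yes _ =
    dist-ultra (s ∘ suc) (dec ∘ s≤s) (pos ∘ suc) (u ∘ suc) (v ∘ suc) (w ∘ suc)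
  ... | yes _ | no _  | _     = inj₁ (dist-≤ s dec pos (u ∘ suc) (w ∘ suc))
  ... | yes _ | yes _ | no _  = inj₂ (dist-≤ s dec pos (u ∘ suc) (w ∘ suc))
  ... | no _  | no _  | _     = inj₁ (inj₂ refl)
  ... | no _  | yes _ | no _  = inj₂ (inj₂ refl)
  ... | no ne | yes e | yes e′ = contradiction (trans e e′) ne

  Tree : ∀ {m} (s : Fin m → T) → Decreasing s → (∀ j → S (s j)) → ℕ → US
  Tree {m} s dec inS M = record
    { size    = M ^ m
    ; d       = λ x y → dist s (coords x) (coords y)
    ; d-zero  = λ x y → mk⇔
        (λ e → finToFun-injective {n = m} (dist-zero s pos (coords x) (coords y) e))
        (λ e → dist-refl s (coords x) (coords y) (λ j → cong (λ z → coords z j) e))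
    ; d-sym   = λ x y → dist-sym s (coords x) (coords y)
    ; d-ultra = λ x y z → dist-ultra s dec pos (coords x) (coords y) (coords z)
    ; d-S     = λ x y x≢y → nonzero x y x≢y (dist-value s (coords x) (coords y))
    }
    where
    coords : Fin (M ^ m) → Fin m → Fin M
    coords = finToFun
    pos : ∀ j → 0# < s j
    pos j = S-positive (s j) (inS j)
    nonzero : ∀ x y → x ≢ y → let δ = dist s (coords x) (coords y) in
              δ ≡ 0# ⊎ Σ (Fin m) (λ j → δ ≡ s j) → S δ
    nonzero x y x≢y (inj₁ e)       =
      contradiction (finToFun-injective {n = m} (dist-zero s pos (coords x) (coords y) e)) x≢y
    nonzero x y x≢y (inj₂ (j , e)) = subst S (sym e) (inS j)

  -- The distances of `Y` as levels.

  descending : T → T → Comparison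
  descending t t′ with compare t t′
  -- The outcomes are swapped so that the largest distance, the coarsest level, comes first.
  ... | tri< _ _ _ = gt
  ... | tri≈ _ _ _ = eq
  ... | tri> _ _ _ = lt

  module Descending where
    open InsertionSort descending public
    open Faithful (flip _<_) (flip <-trans) (<-irrefl refl) id public

    agrees : ∀ t t′ → Agrees (descending t t′) t t′
    agrees t t′ with compare t t′
    ... | tri< t<t′ _ _ = t<t′
    ... | tri≈ _ t≡t′ _ = t≡t′
    ... | tri> _ _ t′<t = t′<t

  module Levels (Y : US) where

    Distinct : Fin (size Y) × Fin (size Y) → Set
    Distinct (x , y) = x ≢ y

    distinct? : ∀ p → Dec (Distinct p)
    distinct? (x , y) = ¬? (x Fin.≟ y)

    -- Diagonal pairs are left out so that `0#` is no level and all levels lie in `S`.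
    pairs : List (Fin (size Y) × Fin (size Y))
    pairs = filter distinct? (cartesianProduct (allFin _) (allFin _))

    levels : List T
    levels = Descending.sort (map (uncurry (d Y)) pairs)

    m : ℕ
    m = length levels

    s : Fin m → T
    s = lookup levels

    s-decreasing : Decreasing s
    s-decreasing = AllPairs-lookup
      (Descending.sort-increasing Descending.agrees (map (uncurry (d Y)) pairs))

    s-S : ∀ j → S (s j)
    s-S j = All.lookup {P = S}
      (Descending.All-sort (All.map⁺ (All.map (λ {p} → d-S Y (proj₁ p) (proj₂ p)) distinct)))
      (∈-lookup j)
      where
      distinct : All Distinct pairs
      distinct = All.all-filter distinct? (cartesianProduct (allFin _) (allFin _))

    s-complete : ∀ x y → d Y x y ≡ 0# ⊎ Σ (Fin m) λ j → d Y x y ≡ s j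
    s-complete x y with x Fin.≟ y
    ... | yes x≡y = inj₁ (from (d-zero Y x y) x≡y)
    ... | no  x≢y = inj₂ (Any.index found , sym (Any.lookup-index found))
      where
      found : Any (_≡ d Y x y) levels
      found = Descending.sort-complete Descending.agrees
        (∈-map⁺ (uncurry (d Y))
          (∈-filter⁺ distinct? (∈-cartesianProduct⁺ (∈-allFin x) (∈-allFin y)) x≢y))

    s-positive : ∀ j → 0# < s j
    s-positive j = S-positive (s j) (s-S j)

    s-antitone : ∀ {i j t} → i Fin.≤ j → t < s j → t < s i
    s-antitone {i} {j} i≤j t<sj with Fin.<-cmp i j
    ... | tri< i<j _ _  = <-trans t<sj (s-decreasing i<j)
    ... | tri≈ _ refl _ = t<sj
    ... | tri> _ _ j<i  = contradiction i≤j (ℕ.<⇒≱ j<i)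

  -- Open balls of `Y`.

  module Balls (Y : US) where

    indicator : T → Fin (size Y) → Fin (size Y) → Fin 2
    indicator t y z = if does (d Y y z <? t) then suc zero else zero

    -- The open ball of radius `t` about `y`, coded by its characteristic function so that equality
    -- of balls is equality of numbers.
    ball : T → Fin (size Y) → Fin (2 ^ size Y)
    ball t y = funToFin (indicator t y)

    <-ultra : ∀ {t} x y z → d Y x y < t → d Y y z < t → d Y x z < t
    <-ultra x y z xy<t yz<t with d-ultra Y x y z
    ... | inj₁ (inj₁ l) = <-trans l xy<t
    ... | inj₁ (inj₂ e) = subst (_< _) (sym e) xy<t
    ... | inj₂ (inj₁ l) = <-trans l yz<t
    ... | inj₂ (inj₂ e) = subst (_< _) (sym e) yz<t

    -- In an ultrametric space every point of a ball is a centre of it.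
    ball-cong : ∀ {t y y′} → d Y y y′ < t → ball t y ≡ ball t y′
    ball-cong {t} {y} {y′} l = funToFin-cong same
      where
      same : ∀ z → indicator t y z ≡ indicator t y′ z
      same z with d Y y z <? t | d Y y′ z <? t
      ... | yes _ | yes _ = refl
      ... | no _  | no _  = refl
      ... | yes p | no ¬q = contradiction (<-ultra y′ y z (subst (_< t) (d-sym Y y y′) l) p) ¬q
      ... | no ¬p | yes q = contradiction (<-ultra y y′ z l q) ¬p

    -- As `0# < t`, the point `y′` is in its own ball, hence in the equal ball about `y`.
    ball-injective : ∀ {t y y′} → 0# < t → ball t y ≡ ball t y′ → d Y y y′ < t
    ball-injective {t} {y} {y′} 0<t e with d Y y y′ <? t | d Y y′ y′ <? t | same
      where
      same : indicator t y y′ ≡ indicator t y′ y′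
      same = trans (sym (Fin.finToFun-funToFin (indicator t y) y′))
               (trans (cong (λ b → finToFun {2} {size Y} b y′) e)
                 (Fin.finToFun-funToFin (indicator t y′) y′))
    ... | yes l | _     | _ = l
    ... | no _  | no ¬l | _ = contradiction (subst (_< t) (sym (from (d-zero Y y′ y′) refl)) 0<t) ¬l

  -- Labels of the ancestors of the points of `Y`.

  module Labels (Y : US) where
    open Levels Y public
    open Balls Y
    open Numbering {Fin (size Y)} (2 ^ size Y)

    N : ℕ
    N = top m 1

    node : Fin m → Fin (size Y) → Fin (2 ^ size Y)
    node j = ball (s j)

    root : Fin (size Y) → Fin 1
    root _ = zero

    label : Fin m → Fin (size Y) → Fin N
    label j y = fromℕ< (number<top node root j y)

    toℕ-label : ∀ j y → toℕ (label j y) ≡ number node root j y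
    toℕ-label j y = Fin.toℕ-fromℕ< (number<top node root j y)

    leaf : Fin (size Y) → Fin N
    leaf = final node root

    label-level-< : ∀ {i j} → i Fin.< j → ∀ y y′ → label i y Fin.< label j y′
    label-level-< {i} {j} i<j y y′ =
      subst₂ ℕ._<_ (sym (toℕ-label i y)) (sym (toℕ-label j y′)) (number-level-< node root i<j y y′)

    -- The last digit identifies the ball; conversely, a common ball at level `j` forces common
    -- balls at all coarser levels, hence equal numbers.
    label≡⇔ : ∀ j y y′ → label j y ≡ label j y′ ⇔ d Y y y′ < s j
    label≡⇔ j y y′ = mk⇔
      (λ e → ball-injective (s-positive j) (number-injective node root j
               (trans (sym (toℕ-label j y)) (trans (cong toℕ e) (toℕ-label j y′)))))
      (λ l → Fin.toℕ-injective (trans (toℕ-label j y) (trans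
               (number-cong node root j refl (λ i≤j → ball-cong (s-antitone i≤j l))) (sym (toℕ-label j y′)))))

    label<⇒leaf< : ∀ j {y y′} → label j y Fin.< label j y′ → leaf y Fin.< leaf y′
    label<⇒leaf< j {y} {y′} l = number<⇒final< node root j
      (subst₂ ℕ._<_ (toℕ-label j y) (toℕ-label j y′) l)

  -- Order types of copies and the partition relation.

  orderTypes : US → ℕ
  -- The number of binary relations on `X`. It depends on neither `Y` nor `k`, so it can serve as
  -- `l`.
  orderTypes X = 2 ^ (size X * size X)

  module Colouring (X Y : US) (k : ℕ) where
    open Labels Y

    n : ℕ
    n = size X

    -- The order type σ codes the relation "f x precedes f x′" on X induced by
    -- the order of the leaves of Y, for a copy f of X.
    OrderType : Set
    OrderType = Fin (orderTypes X)

    Before : OrderType → Fin n → Fin n → Fin 2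
    Before σ x x′ = finToFun σ (combine x x′)

    -- `(j , x)` names the level-`j` ancestor of the point `x`; different pairs can name the same
    -- node.
    Q : Set
    Q = Fin m × Fin n

    precedes : {P : Set} → Dec P → Fin 2
    precedes (yes _) = suc zero
    precedes (no _)  = zero

    tieBreak : Fin 2 → Comparison
    tieBreak zero    = gt
    tieBreak (suc _) = lt

    -- Predicts the order of labels from `X`, the levels and the order type alone, so that it is the
    -- same for all copies of that type.
    cmp : OrderType → Q → Q → Comparison
    cmp σ (i , x) (j , x′) with Fin.<-cmp i j
    ... | tri< _ _ _ = lt
    ... | tri> _ _ _ = gt
    ... | tri≈ _ _ _ with d X x x′ <? s i
    ...   | yes _ = eq
    ...   | no _  = tieBreak (Before σ x x′)

    nodes : List Q
    nodes = cartesianProduct (allFin m) (allFin n)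

    -- For a copy of order type `σ`, this lists its nodes by increasing label, once each; the length
    -- is the exponent in Ramsey's theorem.
    shape : OrderType → List Q
    shape σ = InsertionSort.sort (cmp σ) nodes

    bound : Σ ℕ (FamilyRamseyBound k (length ∘ shape) N)
    bound = ramsey-family k (orderTypes X) (length ∘ shape) N

    M : ℕ
    M = proj₁ bound

    Z : US
    Z = Tree s s-decreasing s-S M

    coords : Fin (M ^ m) → Fin m → Fin M
    coords = finToFun

    IsRealised : OrderType → List (Fin M) → Fin (M ^ m) → Set
    IsRealised σ ts z =
      Σ (Fin n) λ x → ∀ j → InsertionSort.decode (cmp σ) (shape σ) ts (j , x) ≡ just (coords z j)

    isRealised? : ∀ σ ts z → Dec (IsRealised σ ts z)
    isRealised? σ ts z = Fin.any? λ x → Fin.all? λ j → Maybe.≡-dec Fin._≟_ _ _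

    -- Rebuilds a copy from the values `ts` at its nodes, so that a colouring of sets becomes a
    -- colouring of lists.
    realisation : OrderType → List (Fin M) → Subset (M ^ m)
    realisation σ ts = comprehension (isRealised? σ ts)

    before : (Fin n → Fin (size Y)) → Fin n × Fin n → Fin 2
    before f (x , x′) = precedes (leaf (f x) Fin.<? leaf (f x′))

    orderType : (Fin n → Fin (size Y)) → OrderType
    orderType f = funToFin (before f ∘ remQuot n)

    Before-orderType : ∀ f x x′ → Before (orderType f) x x′ ≡ before f (x , x′)
    Before-orderType f x x′ = trans (Fin.finToFun-funToFin (before f ∘ remQuot n) (combine x x′))
      (cong (before f) (Fin.remQuot-combine x x′))

    module Copy (f : Fin n → Fin (size Y)) (iso : ∀ x x′ → d Y (f x) (f x′) ≡ d X x x′) where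

      σ : OrderType
      σ = orderType f

      g : Q → Fin N
      g (j , x) = label j (f x)

      open InsertionSort (cmp σ) public
      open Faithful Fin._<_ Fin.<-trans (Fin.<-irrefl refl) g public

      agrees-tieBreak : ∀ i x x′ (l? : Dec (leaf (f x) Fin.< leaf (f x′))) →
        g (i , x) ≢ g (i , x′) → Agrees (tieBreak (precedes l?)) (i , x) (i , x′)
      agrees-tieBreak i x x′ l? ne with Fin.<-cmp (label i (f x)) (label i (f x′)) | l?
      ... | tri≈ _ e _ | _      = contradiction e ne
      ... | tri< l _ _ | yes _  = l
      ... | tri< l _ _ | no ¬l′ = contradiction (label<⇒leaf< i l) ¬l′
      ... | tri> _ _ l | yes l′ = contradiction (label<⇒leaf< i l) (Fin.<-asym l′)
      ... | tri> _ _ l | no _   = l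

      -- Levels are numbered in turn, `label≡⇔` with `iso` settles coinciding nodes, and the
      -- remaining ones are ordered as the leaves.
      agrees : ∀ q q′ → Agrees (cmp σ q q′) q q′
      agrees (i , x) (j , x′) with Fin.<-cmp i j
      ... | tri< i<j _ _  = label-level-< i<j (f x) (f x′)
      ... | tri> _ _ j<i  = label-level-< j<i (f x′) (f x)
      ... | tri≈ _ refl _ with d X x x′ <? s i
      ...   | yes l = from (label≡⇔ i (f x) (f x′)) (subst (_< s i) (sym (iso x x′)) l)
      ...   | no ¬l =
        subst (λ b → Agrees (tieBreak b) (i , x) (i , x′)) (sym (Before-orderType f x x′))
          (agrees-tieBreak i x x′ (leaf (f x) Fin.<? leaf (f x′))
            λ e → ¬l (subst (_< s i) (iso x x′) (to (label≡⇔ i (f x) (f x′)) e)))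

      g-shape⊆ : map g (shape σ) ⊆ allFin N
      g-shape⊆ = increasing⇒⊆ Fin.<-trans (Fin.<-irrefl refl)
        (AllPairs.map⁺ (sort-increasing agrees nodes)) (allFin-increasing N) (All.universal ∈-allFin _)

      decode-shape : ∀ {A : Set} (h : Fin N → A) j x →
                     decode (shape σ) (map (h ∘ g) (shape σ)) (j , x) ≡ just (h (label j (f x)))
      decode-shape h j x = decode-map agrees h
        (sort-complete agrees (∈-cartesianProduct⁺ (∈-allFin j) (∈-allFin x)))

    arrow : Arrow Z Y X k (orderTypes X)
    -- For each order type `σ`, a list gets the colour of the set it rebuilds.
    arrow χ with proj₂ bound (λ σ → χ ∘ realisation σ) (allFin M)
                   (ℕ.≤-reflexive (sym (List.length-tabulate {n = M} id)))
    ... | ys , ys⊆ , len , γs , hom with enumeration ys ys⊆ len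
    ...   | h , h-injective , h-map = Ỹ , (e , e-iso , Ỹ-image) , γs , few
      where
      e : Fin (size Y) → Fin (M ^ m)
      e y = funToFin (λ j → h (label j y))

      coords-e : ∀ y j → coords (e y) j ≡ h (label j y)
      coords-e y = Fin.finToFun-funToFin (λ j → h (label j y))

      e-iso : ∀ y y′ → d Z (e y) (e y′) ≡ d Y y y′
      -- As `h` is injective, the images agree at coordinate `j` exactly when the labels do, that
      -- is, when `d Y y y′ < s j`.
      e-iso y y′ = dist-unique s s-decreasing s-positive (coords (e y)) (coords (e y′))
        (s-complete y y′) λ j → mk⇔
        (λ eq → to (label≡⇔ j y y′) (h-injective
          (trans (sym (coords-e y j)) (trans eq (coords-e y′ j)))))
        (λ l → trans (coords-e y j) (trans (cong h (from (label≡⇔ j y y′) l)) (sym (coords-e y′ j))))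

      inImage? : ∀ z → Dec (Σ (Fin (size Y)) λ y → e y ≡ z)
      inImage? z = Fin.any? λ y → e y Fin.≟ z

      Ỹ : Subset (M ^ m)
      Ỹ = comprehension inImage?

      Ỹ-image : ∀ z → z Subset.∈ Ỹ ⇔ Σ (Fin (size Y)) λ y → e y ≡ z
      Ỹ-image z = mk⇔ (∈-comprehension⁻ inImage?) (∈-comprehension⁺ inImage?)

      few : ∀ A → A Subset.⊆ Ỹ → IsCopy Z X A → χ A VM.∈ γs
      few A A⊆Ỹ (a , a-iso , A-image) =
        -- `A` is rebuilt from `ts`, a sublist of `ys` of the length of `shape σ`, so it has the
        -- colour recorded for `σ`.
        subst (VM._∈ γs)
          (sym (trans (cong χ A≡) (hom σ ts ts⊆ (List.length-map (h ∘ g) (shape σ)))))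
          (VM.∈-lookup σ γs)
        where
        preimage : ∀ x → Σ (Fin (size Y)) λ y → e y ≡ a x
        preimage x = to (Ỹ-image (a x)) (A⊆Ỹ (from (A-image (a x)) (x , refl)))

        f : Fin n → Fin (size Y)
        f = proj₁ ∘ preimage

        f-iso : ∀ x x′ → d Y (f x) (f x′) ≡ d X x x′
        f-iso x x′ = trans (sym (e-iso (f x) (f x′)))
          (trans (cong₂ (d Z) (proj₂ (preimage x)) (proj₂ (preimage x′))) (a-iso x x′))

        open Copy f f-iso

        ts : List (Fin M)
        ts = map (h ∘ g) (shape σ)

        ts⊆ : ts ⊆ ys
        ts⊆ = subst₂ _⊆_ (sym (List.map-∘ (shape σ))) h-map (Sub.map⁺ h g-shape⊆)

        coords-a : ∀ x j → coords (a x) j ≡ h (label j (f x))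
        coords-a x j = trans (cong (λ z → coords z j) (sym (proj₂ (preimage x)))) (coords-e (f x) j)

        -- Decoding `ts` at `(j , x)` returns coordinate `j` of `a x`, and the coordinates determine
        -- the point.
        A≡ : A ≡ realisation σ ts
        A≡ = Subset.⊆-antisym
          (λ {z} z∈A → ∈-comprehension⁺ (isRealised? σ ts) (realised z (to (A-image z) z∈A)))
          (λ {z} z∈ → from (A-image z) (unrealised z (∈-comprehension⁻ (isRealised? σ ts) z∈)))
          where
          realised : ∀ z → Σ (Fin n) (λ x → a x ≡ z) → IsRealised σ ts z
          realised _ (x , refl) = x , λ j → trans (decode-shape h j x) (cong just (sym (coords-a x j)))
          unrealised : ∀ z → IsRealised σ ts z → Σ (Fin n) (λ x → a x ≡ z)
          unrealised z (x , eqs) = x , finToFun-injective {n = m} λ j → trans (coords-a x j)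
            (Maybe.just-injective (trans (sym (decode-shape h j x)) (eqs j)))

theorem5 : {T : Set} (_<_ : T → T → Set) → IsStrictTotalOrder _≡_ _<_ →
    (0# : T) (S : T → Set) → (∀ s → S s → 0# < s) →
    (X : Ultra.US _<_ 0# S) →
    Σ ℕ λ l → (Y : Ultra.US _<_ 0# S) → (k : ℕ) → k ≢ 0 →
    Σ (Ultra.US _<_ 0# S) λ Z → Ultra.Arrow _<_ 0# S Z Y X k l
theorem5 _<_ isSTO 0# S S-positive X =
  orderTypes X , λ Y k _ → Colouring.Z X Y k , Colouring.arrow X Y k
  where open UltrametricRamsey _<_ isSTO 0# S S-positive
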